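{- For all $r,t\in\mathbb{N}$, every graph $G$ that does not contain the complete graph $K_t$ as a minor satisfies $\operatorname{cw}_r(G)\leq \binom{t-1}{2}(8r+1)$.
   Context: All graphs are finite, simple and undirected; $\mathbb{N}=\{1,2,\dots\}$. Cop-width game with radius $r$ and width $k$ on $G$: initially the cops occupy a set $C_0\subseteq V(G)$ with $|C_0|\le k$ and the robber chooses a vertex $x_0$. In each round $i\ge1$, the cops announce a new set $C_i\subseteq V(G)$ with $|C_i|\le k$; the robber, knowing $C_i$, moves from $x_{i-1}$ to a vertex $x_i$ along a path in $G$ of length at most $r$ containing no vertex of $C_{i-1}\cap C_i$. The robber is caught if $x_i\in C_i$. The radius-$r$ cop-width $\operatorname{cw}_r(G)$ is the least $k\in\mathbb{N}$ such that the cops can guarantee capture in finitely many rounds.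
   Formalization: The theorem is stated for t ≥ 3: for t ≤ 2 the bound is 0, while the cop-width is at least 1 by definition (for example, the one-vertex graph has no K_2 minor and has cop-width 1), so the claim fails there. -}

module Defs where

open import Data.Nat using (ℕ; zero; suc; _≤_)
open import Data.Fin using (Fin)
open import Data.Fin.Subset using (Subset; _∈_; _∉_; _∩_; ∣_∣)
open import Data.Maybe using (Maybe; just)
open import Data.Product using (Σ; ∃; ∃₂; _×_)
open import Data.Sum using (_⊎_)
open import Relation.Binary.PropositionalEquality using (_≡_; _≢_)
open import Relation.Nullary using (¬_)

record Graph : Set₁ where
  field
    n     : ℕ
    Adj   : Fin n → Fin n → Set
    sym   : ∀ {u v} → Adj u v → Adj v u
    irref : ∀ {u} → ¬ Adj u u

module _ (G : Graph) where
  open Graph G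

  data WalkIn (P : Fin n → Set) : Fin n → Fin n → Set where
    here : ∀ {x} → P x → WalkIn P x x
    step : ∀ {x y z} → P x → Adj x y → WalkIn P y z → WalkIn P x z

  -- K_t minor model: disjoint (built in) nonempty connected branch sets,
  -- pairwise joined by an edge.
  record CliqueMinor (t : ℕ) : Set where
    field
      branch    : Fin n → Maybe (Fin t)
      nonempty  : ∀ i → ∃ λ v → branch v ≡ just i
      connected : ∀ i u v → branch u ≡ just i → branch v ≡ just i →
                  WalkIn (λ w → branch w ≡ just i) u v
      adjacent  : ∀ i j → i ≢ j → ∃₂ λ u v →
                  branch u ≡ just i × branch v ≡ just j × Adj u v

  HasCliqueMinor : ℕ → Set
  HasCliqueMinor t = CliqueMinor t

  data Reach (S : Subset n) : ℕ → Fin n → Fin n → Set where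
    here : ∀ {m x} → x ∉ S → Reach S m x x
    step : ∀ {m x y z} → x ∉ S → Adj x y → Reach S m y z → Reach S (suc m) x z

  -- CopsWinFrom r k C x : in the position where the cops currently occupy C
  -- and the robber (not caught) is at x, the cops can force capture in
  -- finitely many rounds (inductive = well-founded attractor).
  data CopsWinFrom (r k : ℕ) : Subset n → Fin n → Set where
    win : ∀ {C x} (C′ : Subset n) → ∣ C′ ∣ ≤ k →
          (∀ x′ → Reach (C ∩ C′) r x x′ → x′ ∈ C′ ⊎ CopsWinFrom r k C′ x′) →
          CopsWinFrom r k C x

  CopsWin : ℕ → ℕ → Set
  CopsWin r k = Σ (Subset n) λ C₀ → ∣ C₀ ∣ ≤ k ×
                (∀ x₀ → x₀ ∈ C₀ ⊎ CopsWinFrom r k C₀ x₀)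

  -- cw_r(G) ≤ B, where cw_r(G) is the least k ∈ {1,2,…} with CopsWin r k
  CopWidthAtMost : ℕ → ℕ → Set
  CopWidthAtMost r B = ∃ λ k → 1 ≤ k × k ≤ B × CopsWin r k

{-# OPTIONS --safe #-}
module Submission where

open import Defs
open import Data.Fin using (Fin; zero; suc; combine; inject≤; _≟_)
open import Data.Fin.Properties using (any?; combine-injective; inject≤-injective)
open import Data.Fin.Subset using (Subset; inside; outside; _∈_; _∉_; _⊆_; _⊂_; _⊃_; _∩_; _∪_; _─_; ⋃; ⁅_⁆; ∣_∣; ⊤) renaming (⊥ to ∅)
open import Data.Fin.Subset.Induction using (⊂-wellFounded; ⊃-wellFounded)
open import Data.Fin.Subset.Properties using (_∈?_; ∉⊥; ∈⊤; ⊥⊆; ⊆-refl; ⊆-trans; ⊆-⊂-trans; ∣⊥∣≡0; ∣⁅x⁆∣≡1; x∈⁅x⁆; x∈⁅y⁆⇒x≡y; p⊆q⇒∣p∣≤∣q∣; x∈p∪q⁻; p⊆p∪q; q⊆p∪q; x∈p∩q⁺; x∈p∩q⁻; ∣p∩q∣≤∣p∣; ∩-distribʳ-∪; p─q⊆p; x∈p∧x∉q⇒x∈p─q; p∩q≢∅⇒p─q⊂p)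
open import Data.List using (List; []; _∷_; length; lookup; filter)
open import Data.List.Membership.Propositional using (find; lose)
open import Data.List.Membership.Propositional.Properties using (∈-filter⁺; ∈-lookup)
open import Data.List.Relation.Unary.All as All using (All; []; _∷_)
open import Data.List.Relation.Unary.All.Properties using (all-filter) renaming (filter⁺ to All-filter⁺)
open import Data.List.Relation.Unary.AllPairs using (AllPairs; []; _∷_)
open import Data.List.Relation.Unary.AllPairs.Properties using () renaming (filter⁺ to AllPairs-filter⁺)
open import Data.List.Relation.Unary.Any using (Any; here; there)
open import Data.Maybe using (Maybe; just; nothing)
open import Data.Nat using (ℕ; zero; suc; _≤_; _*_; _+_; _∸_; z≤n; s≤s)
open import Data.Nat.Combinatorics using (_C_; nC1≡n; nCk+nC[k+1]≡[n+1]C[k+1])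
open import Data.Nat.Properties using (≤-refl; ≤-trans; ≤-reflexive; ≤-pred; m≤m+n; m≤n+m; n≤1+n; +-suc; +-mono-≤; +-monoʳ-≤; +-cancelʳ-≤; *-monoˡ-≤; *-cancelˡ-≤; *-assoc; *-distribˡ-+; ≰⇒>; module ≤-Reasoning)
open import Data.Nat.Tactic.RingSolver using (solve-∀)
open import Data.Product as Product using (∃; ∃₂; _×_; _,_; proj₁; proj₂)
open import Data.Sum as Sum using (_⊎_; inj₁; inj₂; [_,_]′)
open import Data.Vec using ([]; _∷_; here; there; tabulate)
open import Data.Vec.Properties using ([]=⇒lookup; lookup⇒[]=; lookup∘tabulate)
open import Function using (_∘_)
open import Induction.WellFounded using (Acc; acc)
open import Relation.Binary.Definitions using (Decidable; Symmetric)
open import Relation.Binary.PropositionalEquality using (_≡_; _≢_; refl; sym; trans; cong; cong₂; subst; module ≡-Reasoning)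
open import Relation.Nullary using (¬_; Dec; does; yes; no; contradiction)
open import Relation.Nullary.Decidable using (_×-dec_; _⊎-dec_; ¬?; map′; dec-true)
import Relation.Unary as Unary

-- The robber is kept in a connected territory X whose boundary lies in "bags":
-- connected, pairwise disjoint and adjacent sets, all adjacent to X. Together
-- with X they form a clique minor, so there are at most t - 2 of them. In each
-- round the cops add a bag N, the union of geodesics of X from the robber's
-- vertex to the existing bags, and pass to the component of X - N containing
-- the robber; bags no longer adjacent to it are discarded. Only bag vertices
-- within distance 2r - 1 of the robber need cops, and a geodesic has at most
-- 4r - 1 of these, so (t - 1)((t - 2)(4r - 1) + 1) cops suffice.
--
-- Adjacency is not assumed decidable. The cops therefore play on the subgraph of
-- edges seen so far; a robber move outside it reveals a new edge, after which
-- they start again, and this happens only finitely often.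

x∈p⇒⁅x⁆⊆p : ∀ {n x} {p : Subset n} → x ∈ p → ⁅ x ⁆ ⊆ p
x∈p⇒⁅x⁆⊆p {x = x} x∈p z∈⁅x⁆ with refl ← x∈⁅y⁆⇒x≡y x z∈⁅x⁆ = x∈p

p⊆r∧q⊆r⇒p∪q⊆r : ∀ {n} {p q r : Subset n} → p ⊆ r → q ⊆ r → p ∪ q ⊆ r
p⊆r∧q⊆r⇒p∪q⊆r {p = p} {q} p⊆r q⊆r = [ p⊆r , q⊆r ]′ ∘ x∈p∪q⁻ p q

∩-mono-⊆ : ∀ {n} {p p′ q q′ : Subset n} → p ⊆ p′ → q ⊆ q′ → p ∩ q ⊆ p′ ∩ q′
∩-mono-⊆ {p = p} {q = q} p⊆p′ q⊆q′ = x∈p∩q⁺ ∘ Product.map p⊆p′ q⊆q′ ∘ x∈p∩q⁻ p q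

x∉p⇒p⊂p∪⁅x⁆ : ∀ {n x} {p : Subset n} → x ∉ p → p ⊂ p ∪ ⁅ x ⁆
x∉p⇒p⊂p∪⁅x⁆ {x = x} x∉p = p⊆p∪q _ , x , q⊆p∪q _ _ (x∈⁅x⁆ x) , x∉p

x∈p─q⇒x∉q : ∀ {n x} (p q : Subset n) → x ∈ p ─ q → x ∉ q
x∈p─q⇒x∉q (_ ∷ p) (_ ∷ q) (there x∈p─q) (there x∈q) = x∈p─q⇒x∉q p q x∈p─q x∈q

∣p∪q∣≤∣p∣+∣q∣ : ∀ {n} (p q : Subset n) → ∣ p ∪ q ∣ ≤ ∣ p ∣ + ∣ q ∣
∣p∪q∣≤∣p∣+∣q∣ [] [] = z≤n
∣p∪q∣≤∣p∣+∣q∣ (inside ∷ p) (inside ∷ q) =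
  s≤s (≤-trans (∣p∪q∣≤∣p∣+∣q∣ p q) (+-monoʳ-≤ ∣ p ∣ (n≤1+n ∣ q ∣)))
∣p∪q∣≤∣p∣+∣q∣ (inside ∷ p) (outside ∷ q) = s≤s (∣p∪q∣≤∣p∣+∣q∣ p q)
∣p∪q∣≤∣p∣+∣q∣ (outside ∷ p) (inside ∷ q) =
  ≤-trans (s≤s (∣p∪q∣≤∣p∣+∣q∣ p q)) (≤-reflexive (sym (+-suc ∣ p ∣ ∣ q ∣)))
∣p∪q∣≤∣p∣+∣q∣ (outside ∷ p) (outside ∷ q) = ∣p∪q∣≤∣p∣+∣q∣ p q

∈-⋃⁺ : ∀ {n x} {ps : List (Subset n)} → Any (x ∈_) ps → x ∈ ⋃ ps
∈-⋃⁺ (here x∈p) = p⊆p∪q _ x∈p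
∈-⋃⁺ (there x∈ps) = q⊆p∪q _ _ (∈-⋃⁺ x∈ps)

∈-⋃⁻ : ∀ {n x} (ps : List (Subset n)) → x ∈ ⋃ ps → Any (x ∈_) ps
∈-⋃⁻ [] x∈∅ = contradiction x∈∅ ∉⊥
∈-⋃⁻ (p ∷ ps) = [ here , there ∘ ∈-⋃⁻ ps ]′ ∘ x∈p∪q⁻ p (⋃ ps)

module _ {n ℓ} {P : Unary.Pred (Fin n) ℓ} (P? : Unary.Decidable P) where

  comprehension : Subset n
  comprehension = tabulate (does ∘ P?)

  ∈-comprehension⁺ : ∀ {x} → P x → x ∈ comprehension
  ∈-comprehension⁺ {x} px =
    lookup⇒[]= x comprehension (trans (lookup∘tabulate (does ∘ P?) x) (dec-true (P? x) px))

  ∈-comprehension⁻ : ∀ {x} → x ∈ comprehension → P x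
  ∈-comprehension⁻ {x} x∈
    with P? x | trans (sym (lookup∘tabulate (does ∘ P?) x)) ([]=⇒lookup x∈)
  ... | yes px | _ = px

AllPairs-lookup : ∀ {a ℓ} {A : Set a} {R : A → A → Set ℓ} → Symmetric R →
                  ∀ {xs} → AllPairs R xs → ∀ {i j} → i ≢ j → R (lookup xs i) (lookup xs j)
AllPairs-lookup symR (rx ∷ rs) {zero} {zero} i≢j = contradiction refl i≢j
AllPairs-lookup symR (rx ∷ rs) {zero} {suc j} i≢j = All.lookup rx (∈-lookup j)
AllPairs-lookup symR (rx ∷ rs) {suc i} {zero} i≢j = symR (All.lookup rx (∈-lookup i))
AllPairs-lookup symR (rx ∷ rs) {suc i} {suc j} i≢j = AllPairs-lookup symR rs (i≢j ∘ cong suc)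

module Walks (G : Graph) where
  open Graph G renaming (sym to Adj-sym)

  -- The end vertex need not lie in X, so that walks can reach its boundary.
  data Within (X : Subset n) : ℕ → Fin n → Fin n → Set where
    here : ∀ {m x} → Within X m x x
    step : ∀ {m x y z} → x ∈ X → Adj x y → Within X m y z → Within X (suc m) x z

  Within-⊆ : ∀ {X Y m x y} → X ⊆ Y → Within X m x y → Within Y m x y
  Within-⊆ X⊆Y here = here
  Within-⊆ X⊆Y (step x∈X xy w) = step (X⊆Y x∈X) xy (Within-⊆ X⊆Y w)

  Within-≤ : ∀ {X m m′ x y} → m ≤ m′ → Within X m x y → Within X m′ x y
  Within-≤ m≤m′ here = here
  Within-≤ (s≤s m≤m′) (step x∈X xy w) = step x∈X xy (Within-≤ m≤m′ w)

  Within-trans : ∀ {X m m′ x y z} → Within X m x y → Within X m′ y z → Within X (m + m′) x z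
  Within-trans {m = m} {m′} here w = Within-≤ (m≤n+m m′ m) w
  Within-trans (step x∈X xy v) w = step x∈X xy (Within-trans v w)

  Within-start : ∀ {X m x y} → Within X m x y → y ∈ X → x ∈ X
  Within-start here y∈X = y∈X
  Within-start (step x∈X _ _) _ = x∈X

  Within-snoc : ∀ {X m x y z} → Within X m x y → y ∈ X → Adj y z → Within X (suc m) x z
  Within-snoc here y∈X yz = step y∈X yz here
  Within-snoc (step x∈X xy w) y∈X yz = step x∈X xy (Within-snoc w y∈X yz)

  Within-sym : ∀ {X m x y} → Within X m x y → y ∈ X → Within X m y x
  Within-sym here _ = here
  Within-sym (step x∈X xy w) y∈X = Within-snoc (Within-sym w y∈X) (Within-start w y∈X) (Adj-sym xy)

  Within⇒WalkIn : ∀ {X m x y} {P : Fin n → Set} → (∀ {z} → z ∈ X → P z) → P y →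
                  Within X m x y → WalkIn G P x y
  Within⇒WalkIn X⊆P py here = here py
  Within⇒WalkIn X⊆P py (step x∈X xy w) = step (X⊆P x∈X) xy (Within⇒WalkIn X⊆P py w)

  Boundary : Subset n → Fin n → Set
  Boundary X p = p ∉ X × ∃ λ z → z ∈ X × Adj z p

  Within-exit : ∀ {X m x p} → x ∈ X → p ∉ X → Within X m x p → Boundary X p
  Within-exit x∈X p∉X here = contradiction x∈X p∉X
  Within-exit _ p∉X (step x∈X xp here) = p∉X , _ , x∈X , xp
  Within-exit _ p∉X (step _ _ w@(step y∈X _ _)) = Within-exit y∈X p∉X w

  Rooted : Subset n → Fin n → Set
  Rooted S x = x ∈ S × (∀ {z} → z ∈ S → ∃ λ m → Within S m x z)

  Connected : Subset n → Set
  Connected S = ∃ (Rooted S)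

  Connected⇒Within : ∀ {S u v} → Connected S → u ∈ S → v ∈ S → ∃ λ m → Within S m u v
  Connected⇒Within (_ , _ , from) u∈S v∈S =
    let m , w = from u∈S
        m′ , w′ = from v∈S
    in m + m′ , Within-trans (Within-sym w u∈S) w′

  Rooted-⁅⁆ : ∀ x → Rooted ⁅ x ⁆ x
  Rooted-⁅⁆ x = x∈⁅x⁆ x , λ z∈⁅x⁆ → 0 , subst (Within _ 0 x) (sym (x∈⁅y⁆⇒x≡y x z∈⁅x⁆)) here

  Rooted-∪ : ∀ {S T x} → Rooted S x → Rooted T x → Rooted (S ∪ T) x
  Rooted-∪ {S} {T} (x∈S , fromS) (_ , fromT) =
    p⊆p∪q T x∈S ,
    [ Product.map₂ (Within-⊆ (p⊆p∪q T)) ∘ fromS , Product.map₂ (Within-⊆ (q⊆p∪q S T)) ∘ fromT ]′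
      ∘ x∈p∪q⁻ S T

  Rooted-∪⁅⁆ : ∀ {S x u v} → Rooted S x → u ∈ S → Adj u v → Rooted (S ∪ ⁅ v ⁆) x
  Rooted-∪⁅⁆ {S} {x} {u} {v} (x∈S , from) u∈S uv = p⊆p∪q _ x∈S , [ toS , tov ]′ ∘ x∈p∪q⁻ S ⁅ v ⁆
    where
    toS : ∀ {z} → z ∈ S → ∃ λ m → Within (S ∪ ⁅ v ⁆) m x z
    toS = Product.map₂ (Within-⊆ (p⊆p∪q _)) ∘ from

    tov : ∀ {z} → z ∈ ⁅ v ⁆ → ∃ λ m → Within (S ∪ ⁅ v ⁆) m x z
    tov z∈⁅v⁆ with refl ← x∈⁅y⁆⇒x≡y v z∈⁅v⁆ =
      Product.map suc (λ w → Within-snoc w (p⊆p∪q _ u∈S) uv) (toS u∈S)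

  Rooted-⁅⁆∪ : ∀ {S x y} → Adj x y → Rooted S y → Rooted (⁅ x ⁆ ∪ S) x
  Rooted-⁅⁆∪ {S} {x} xy (_ , from) = x∈⁅x⁆∪S , [ tox , toS ]′ ∘ x∈p∪q⁻ ⁅ x ⁆ S
    where
    x∈⁅x⁆∪S : x ∈ ⁅ x ⁆ ∪ S
    x∈⁅x⁆∪S = p⊆p∪q S (x∈⁅x⁆ x)

    tox : ∀ {z} → z ∈ ⁅ x ⁆ → ∃ λ m → Within (⁅ x ⁆ ∪ S) m x z
    tox z∈⁅x⁆ with refl ← x∈⁅y⁆⇒x≡y x z∈⁅x⁆ = 0 , here

    toS : ∀ {z} → z ∈ S → ∃ λ m → Within (⁅ x ⁆ ∪ S) m x z
    toS = Product.map suc (step x∈⁅x⁆∪S xy ∘ Within-⊆ (q⊆p∪q ⁅ x ⁆ S)) ∘ from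

  vertices : ∀ {X m x y} → Within X m x y → Subset n
  vertices (here {x = x}) = ⁅ x ⁆
  vertices (step {x = x} _ _ w) = ⁅ x ⁆ ∪ vertices w

  end∈vertices : ∀ {X m x y} (w : Within X m x y) → y ∈ vertices w
  end∈vertices here = x∈⁅x⁆ _
  end∈vertices (step _ _ w) = q⊆p∪q _ _ (end∈vertices w)

  vertices⊆ : ∀ {X m x y} (w : Within X m x y) → y ∈ X → vertices w ⊆ X
  vertices⊆ here y∈X = x∈p⇒⁅x⁆⊆p y∈X
  vertices⊆ (step x∈X _ w) y∈X = p⊆r∧q⊆r⇒p∪q⊆r (x∈p⇒⁅x⁆⊆p x∈X) (vertices⊆ w y∈X)

  Rooted-vertices : ∀ {X m x y} (w : Within X m x y) → Rooted (vertices w) x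
  Rooted-vertices here = Rooted-⁅⁆ _
  Rooted-vertices (step _ xy w) = Rooted-⁅⁆∪ xy (Rooted-vertices w)

  prefix : ℕ → ∀ {X m x y} → Within X m x y → Subset n
  prefix zero _ = ∅
  prefix (suc k) (here {x = x}) = ⁅ x ⁆
  prefix (suc k) (step {x = x} _ _ w) = ⁅ x ⁆ ∪ prefix k w

  ∣prefix∣≤ : ∀ k {X m x y} (w : Within X m x y) → ∣ prefix k w ∣ ≤ k
  ∣prefix∣≤ zero _ = ≤-reflexive (∣⊥∣≡0 n)
  ∣prefix∣≤ (suc k) (here {x = x}) = ≤-trans (≤-reflexive (∣⁅x⁆∣≡1 x)) (s≤s z≤n)
  ∣prefix∣≤ (suc k) (step {x = x} _ _ w) =
    ≤-trans (∣p∪q∣≤∣p∣+∣q∣ ⁅ x ⁆ (prefix k w))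
            (+-mono-≤ (≤-reflexive (∣⁅x⁆∣≡1 x)) (∣prefix∣≤ k w))

  prefix-mono : ∀ {k k′ X m x y} → k ≤ k′ → (w : Within X m x y) → prefix k w ⊆ prefix k′ w
  prefix-mono z≤n w = ⊥⊆
  prefix-mono (s≤s _) here = ⊆-refl
  prefix-mono (s≤s k≤k′) (step _ _ w) =
    p⊆r∧q⊆r⇒p∪q⊆r (p⊆p∪q _) (⊆-trans (prefix-mono k≤k′ w) (q⊆p∪q _ _))

  vertices-split : ∀ {X m x y p} (w : Within X m x y) → p ∈ vertices w →
                   ∃₂ λ i j → i + j ≡ m × p ∈ prefix (suc i) w × Within X j p y
  vertices-split {x = x} here p∈ with refl ← x∈⁅y⁆⇒x≡y x p∈ = 0 , _ , refl , p∈ , here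
  vertices-split w@(step {x = x} _ _ v) p∈ with x∈p∪q⁻ ⁅ x ⁆ (vertices v) p∈
  ... | inj₁ p∈⁅x⁆ with refl ← x∈⁅y⁆⇒x≡y x p∈⁅x⁆ = 0 , _ , refl , p⊆p∪q _ p∈⁅x⁆ , w
  ... | inj₂ p∈v =
    let i , j , i+j≡m , p∈prefix , rest = vertices-split v p∈v
    in suc i , j , cong suc i+j≡m , q⊆p∪q _ _ p∈prefix , rest

  Shortest : ∀ {X m x y} → Within X m x y → Set
  Shortest {X} {m} {x} {y} _ = ∀ {k} → Within X k x y → m ≤ k

  Shortest-prefix : ∀ {X m d x y p} (w : Within X m x y) → Shortest w →
                    p ∈ vertices w → Within X d x p → p ∈ prefix (suc d) w
  Shortest-prefix {d = d} w shortest p∈w xp =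
    let i , j , i+j≡m , p∈prefix , py = vertices-split w p∈w
        i≤d = +-cancelʳ-≤ j i d (subst (_≤ d + j) (sym i+j≡m) (shortest (Within-trans xp py)))
    in prefix-mono (s≤s i≤d) w p∈prefix

module CliqueMinors (G : Graph) where
  open Graph G renaming (sym to Adj-sym)
  open Walks G

  Disjoint : Subset n → Subset n → Set
  Disjoint A B = ∀ v → v ∈ A → v ∉ B

  Disjoint-⊆ : ∀ {A A′ B} → A ⊆ A′ → Disjoint A′ B → Disjoint A B
  Disjoint-⊆ A⊆A′ disjoint v = disjoint v ∘ A⊆A′

  Touch : Subset n → Subset n → Set
  Touch A B = ∃ λ u → u ∈ A × ∃ λ v → v ∈ B × Adj u v

  Touch-⊆ : ∀ {A A′ B} → A ⊆ A′ → Touch A B → Touch A′ B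
  Touch-⊆ A⊆A′ = Product.map₂ (Product.map₁ A⊆A′)

  Joined : Subset n → Subset n → Set
  Joined A B = Disjoint A B × Touch A B

  Joined-sym : Symmetric Joined
  Joined-sym (disjoint , u , u∈A , v , v∈B , uv) =
    (λ x x∈B x∈A → disjoint x x∈A x∈B) , v , v∈B , u , u∈A , Adj-sym uv

  branchSets⇒CliqueMinor : ∀ {t} (B : Fin t → Subset n) → (∀ i → Connected (B i)) →
                           (∀ {i j} → i ≢ j → Joined (B i) (B j)) → CliqueMinor G t
  branchSets⇒CliqueMinor {t} B connected joined = record
    { branch = branch
    ; nonempty = λ i → Product.map₂ (branch⁺ ∘ proj₁) (connected i)
    ; connected = λ i u v u∈ v∈ →
        let _ , w = Connected⇒Within (connected i) (branch⁻ u u∈) (branch⁻ v v∈)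
        in Within⇒WalkIn branch⁺ v∈ w
    ; adjacent = λ i j i≢j →
        let _ , u , u∈ , v , v∈ , uv = joined i≢j
        in u , v , branch⁺ u∈ , branch⁺ v∈ , uv
    }
    where
    branch : Fin n → Maybe (Fin t)
    branch v with any? (λ i → v ∈? B i)
    ... | yes (i , _) = just i
    ... | no _ = nothing

    branch⁻ : ∀ v {i} → branch v ≡ just i → v ∈ B i
    branch⁻ v eq with any? (λ i → v ∈? B i)
    branch⁻ v refl | yes (_ , v∈) = v∈

    branch⁺ : ∀ {v i} → v ∈ B i → branch v ≡ just i
    branch⁺ {v} {i} v∈Bᵢ with any? (λ i → v ∈? B i)
    ... | no v∉B = contradiction (i , v∈Bᵢ) v∉B
    ... | yes (j , v∈Bⱼ) with j ≟ i
    ... | yes j≡i = cong just j≡i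
    ... | no j≢i = contradiction v∈Bᵢ (proj₁ (joined j≢i) v v∈Bⱼ)

  ¬CliqueMinor⇒length≤ : ∀ {t Bs} → ¬ CliqueMinor G (suc t) →
                         All Connected Bs → AllPairs Joined Bs → length Bs ≤ t
  ¬CliqueMinor⇒length≤ {t} {Bs} noMinor connected joined = ≤-pred (≰⇒> λ t<length →
    noMinor (branchSets⇒CliqueMinor
      (λ i → lookup Bs (inject≤ i t<length))
      (λ i → All.lookup connected (∈-lookup (inject≤ i t<length)))
      (λ i≢j → AllPairs-lookup Joined-sym joined (i≢j ∘ inject≤-injective t<length t<length _ _))))

-- The number of vertices of a geodesic that fit into a ball of radius ρ.
window : ℕ → ℕ
window ρ = suc (ρ + ρ)

module Geodesics (G : Graph) (adj? : Decidable (Graph.Adj G)) where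
  open Graph G hiding (sym)
  open Walks G

  within? : ∀ X m x y → Dec (Within X m x y)
  within? X zero x y = map′ (λ { refl → here }) (λ { here → refl }) (x ≟ y)
  within? X (suc m) x y = map′
    (λ { (inj₁ refl) → here ; (inj₂ (x∈X , _ , xz , w)) → step x∈X xz w })
    (λ { here → inj₁ refl ; (step x∈X xz w) → inj₂ (x∈X , _ , xz , w) })
    (x ≟ y ⊎-dec x ∈? X ×-dec any? (λ z → adj? x z ×-dec within? X m z y))

  geodesic : ∀ {X m x y} → Within X m x y → ∃₂ λ k (w : Within X k x y) → Shortest w
  geodesic {m = zero} w = 0 , w , λ _ → z≤n
  geodesic {X} {suc m} {x} {y} w with within? X m x y
  ... | yes shorter = geodesic shorter
  ... | no ¬shorter = suc m , w , λ v → ≰⇒> λ k≤m → ¬shorter (Within-≤ k≤m v)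

  -- Abstract so that a ball determines its arguments during unification.
  abstract
    ball : Subset n → ℕ → Fin n → Subset n
    ball X ρ x = comprehension (within? X ρ x)

    ∈-ball⁺ : ∀ {X ρ x y} → Within X ρ x y → y ∈ ball X ρ x
    ∈-ball⁺ = ∈-comprehension⁺ (within? _ _ _)

    ∈-ball⁻ : ∀ {X ρ x y} → y ∈ ball X ρ x → Within X ρ x y
    ∈-ball⁻ = ∈-comprehension⁻ (within? _ _ _)

  ball-⊆ : ∀ {X Y ρ x} → X ⊆ Y → ball X ρ x ⊆ ball Y ρ x
  ball-⊆ X⊆Y = ∈-ball⁺ ∘ Within-⊆ X⊆Y ∘ ∈-ball⁻

  record Thin (ρ b : ℕ) (X N : Subset n) : Set where
    constructor thin
    field
      ∣∩ball∣≤ : ∀ {x} → x ∈ X → ∣ N ∩ ball X ρ x ∣ ≤ b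

  open Thin public

  Thin-⊆ : ∀ {ρ b X Y N} → Y ⊆ X → Thin ρ b X N → Thin ρ b Y N
  Thin-⊆ {ρ} {b} {X} {Y} {N} Y⊆X N-thin = thin λ {y} y∈Y → begin
    ∣ N ∩ ball Y ρ y ∣  ≤⟨ p⊆q⇒∣p∣≤∣q∣ (∩-mono-⊆ {p = N} ⊆-refl (ball-⊆ Y⊆X)) ⟩
    ∣ N ∩ ball X ρ y ∣  ≤⟨ ∣∩ball∣≤ N-thin (Y⊆X y∈Y) ⟩
    b                   ∎
    where open ≤-Reasoning

  Thin-≤ : ∀ {ρ b b′ X N} → b ≤ b′ → Thin ρ b X N → Thin ρ b′ X N
  Thin-≤ b≤b′ N-thin = thin λ x∈X → ≤-trans (∣∩ball∣≤ N-thin x∈X) b≤b′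

  Thin-∪ : ∀ {ρ b b′ X N N′} → Thin ρ b X N → Thin ρ b′ X N′ → Thin ρ (b + b′) X (N ∪ N′)
  Thin-∪ {ρ} {b} {b′} {X} {N} {N′} N-thin N′-thin = thin λ {x} x∈X → begin
    ∣ (N ∪ N′) ∩ ball X ρ x ∣                 ≡⟨ cong ∣_∣ (∩-distribʳ-∪ (ball X ρ x) N N′) ⟩
    ∣ (N ∩ ball X ρ x) ∪ (N′ ∩ ball X ρ x) ∣  ≤⟨ ∣p∪q∣≤∣p∣+∣q∣ (N ∩ ball X ρ x) _ ⟩
    ∣ N ∩ ball X ρ x ∣ + ∣ N′ ∩ ball X ρ x ∣  ≤⟨ +-mono-≤ (∣∩ball∣≤ N-thin x∈X) (∣∩ball∣≤ N′-thin x∈X) ⟩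
    b + b′                                    ∎
    where open ≤-Reasoning

  Thin-∅ : ∀ {ρ X} → Thin ρ 0 X ∅
  Thin-∅ = thin λ _ → ≤-trans (∣p∩q∣≤∣p∣ {n} ∅ _) (≤-reflexive (∣⊥∣≡0 n))

  Thin-⋃ : ∀ {ρ b X Ns} → All (Thin ρ b X) Ns → Thin ρ (length Ns * b) X (⋃ Ns)
  Thin-⋃ [] = Thin-∅
  Thin-⋃ (N-thin ∷ Ns-thin) = Thin-∪ N-thin (Thin-⋃ Ns-thin)

  Thin-⁅⁆ : ∀ {ρ X} x → Thin ρ 1 X ⁅ x ⁆
  Thin-⁅⁆ x = thin λ _ → ≤-trans (∣p∩q∣≤∣p∣ ⁅ x ⁆ _) (≤-reflexive (∣⁅x⁆∣≡1 x))

  -- Cut the walk at its first vertex a in the ball: everything else in the ball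
  -- is within 2ρ of a, hence among the first 2ρ + 1 vertices from a on.
  ∣Shortest∩ball∣≤window : ∀ {X m ρ a b x} (w : Within X m a b) → Shortest w →
                           ∣ vertices w ∩ ball X ρ x ∣ ≤ window ρ
  ∣Shortest∩ball∣≤window {ρ = ρ} (here {x = a}) _ = begin
    ∣ ⁅ a ⁆ ∩ ball _ ρ _ ∣  ≤⟨ ∣p∩q∣≤∣p∣ ⁅ a ⁆ _ ⟩
    ∣ ⁅ a ⁆ ∣               ≡⟨ ∣⁅x⁆∣≡1 a ⟩
    1                       ≤⟨ s≤s z≤n ⟩
    window ρ                ∎
    where open ≤-Reasoning
  ∣Shortest∩ball∣≤window {X} {ρ = ρ} {x = x} w@(step {x = a} a∈X ac v) shortest with within? X ρ x a
  ... | yes xa = ≤-trans (p⊆q⇒∣p∣≤∣q∣ inWindow) (∣prefix∣≤ (window ρ) w)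
    where
    inWindow : vertices w ∩ ball X ρ x ⊆ prefix (window ρ) w
    inWindow p∈ =
      let p∈w , p∈ball = x∈p∩q⁻ (vertices w) (ball X ρ x) p∈
      in Shortest-prefix w shortest p∈w (Within-trans (Within-sym xa a∈X) (∈-ball⁻ p∈ball))
  ... | no ¬xa = ≤-trans (p⊆q⇒∣p∣≤∣q∣ inTail)
                         (∣Shortest∩ball∣≤window v (λ u → ≤-pred (shortest (step a∈X ac u))))
    where
    inTail : vertices w ∩ ball X ρ x ⊆ vertices v ∩ ball X ρ x
    inTail p∈ with x∈p∩q⁻ (vertices w) (ball X ρ x) p∈
    ... | p∈w , p∈ball with x∈p∪q⁻ ⁅ a ⁆ (vertices v) p∈w
    ... | inj₁ p∈⁅a⁆ with refl ← x∈⁅y⁆⇒x≡y a p∈⁅a⁆ = contradiction (∈-ball⁻ p∈ball) ¬xa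
    ... | inj₂ p∈v = x∈p∩q⁺ (p∈v , p∈ball)

  Shortest⇒Thin : ∀ {X m ρ a b} (w : Within X m a b) → Shortest w → Thin ρ (window ρ) X (vertices w)
  Shortest⇒Thin w shortest = thin λ _ → ∣Shortest∩ball∣≤window w shortest

module Territories (G : Graph) (adj? : Decidable (Graph.Adj G)) where
  open Graph G hiding (sym)
  open Walks G
  open CliqueMinors G
  open Geodesics G adj?

  touch? : ∀ A B → Dec (Touch A B)
  touch? A B = any? λ u → u ∈? A ×-dec any? λ v → v ∈? B ×-dec adj? u v

  boundary? : ∀ X p → Dec (Boundary X p)
  boundary? X p = ¬? (p ∈? X) ×-dec any? λ z → z ∈? X ×-dec adj? z p

  Closed : Subset n → Subset n → Set
  Closed X S = ∀ {p} → Boundary S p → p ∉ X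

  record Component (X : Subset n) (x : Fin n) : Set where
    field
      carrier   : Subset n
      rooted    : Rooted carrier x
      carrier⊆X : carrier ⊆ X
      closed    : Closed X carrier

  component : ∀ {X x} → x ∈ X → Component X x
  component {X} {x} x∈X = grow (⊃-wellFounded ⁅ x ⁆) (Rooted-⁅⁆ x) (x∈p⇒⁅x⁆⊆p x∈X)
    where
    grow : ∀ {S} → Acc _⊃_ S → Rooted S x → S ⊆ X → Component X x
    grow {S} (acc rec) rooted S⊆X with any? (λ v → boundary? S v ×-dec v ∈? X)
    ... | yes (v , (v∉S , u , u∈S , uv) , v∈X) =
      grow (rec (x∉p⇒p⊂p∪⁅x⁆ v∉S)) (Rooted-∪⁅⁆ rooted u∈S uv)
           (p⊆r∧q⊆r⇒p∪q⊆r S⊆X (x∈p⇒⁅x⁆⊆p v∈X))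
    ... | no ¬exit = record
      { carrier   = S
      ; rooted    = rooted
      ; carrier⊆X = S⊆X
      ; closed    = λ ∂v v∈X → ¬exit (_ , ∂v , v∈X)
      }

  record Fan (ρ : ℕ) (X : Subset n) (x : Fin n) (Bs : List (Subset n)) : Set where
    field
      carrier   : Subset n
      rooted    : Rooted carrier x
      carrier⊆X : carrier ⊆ X
      touching  : All (Touch carrier) Bs
      thin-in-X : Thin ρ (suc (length Bs * window ρ)) X carrier

  fan : ∀ {ρ X x Bs} → Connected X → x ∈ X → All (Touch X) Bs → Fan ρ X x Bs
  fan {x = x} connX x∈X [] = record
    { carrier   = ⁅ x ⁆
    ; rooted    = Rooted-⁅⁆ x
    ; carrier⊆X = x∈p⇒⁅x⁆⊆p x∈X
    ; touching  = []
    ; thin-in-X = Thin-⁅⁆ x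
    }
  fan {ρ} {Bs = _ ∷ Bs} connX x∈X ((u , u∈X , uB) ∷ touches)
    with _ , path , shortest ← geodesic (proj₂ (Connected⇒Within connX x∈X u∈X)) = record
    { carrier   = vertices path ∪ carrier
    ; rooted    = Rooted-∪ (Rooted-vertices path) rooted
    ; carrier⊆X = p⊆r∧q⊆r⇒p∪q⊆r (vertices⊆ path u∈X) carrier⊆X
    ; touching  = (u , p⊆p∪q carrier (end∈vertices path) , uB)
                ∷ All.map (Touch-⊆ (q⊆p∪q (vertices path) carrier)) touching
    ; thin-in-X = Thin-≤ (≤-reflexive (+-suc (window ρ) (length Bs * window ρ)))
                         (Thin-∪ (Shortest⇒Thin path shortest) thin-in-X)
    }
    where open Fan (fan {ρ} connX x∈X touches)

  record Enclosure (ρ b : ℕ) (X : Subset n) (bags : List (Subset n)) : Set where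
    field
      connected : All Connected bags
      joined    : AllPairs Joined bags
      disjoint  : All (Disjoint X) bags
      thin-in-X : All (Thin ρ b X) bags
      boundary  : ∀ {p} → Boundary X p → p ∈ ⋃ bags

  Enclosure-⊤ : ∀ {ρ b} → Enclosure ρ b ⊤ []
  Enclosure-⊤ = record
    { connected = []
    ; joined    = []
    ; disjoint  = []
    ; thin-in-X = []
    ; boundary  = λ (p∉⊤ , _) → contradiction ∈⊤ p∉⊤
    }

  Enclosure-─ : ∀ {ρ b X N bags} → N ⊆ X → Connected N → All (Touch N) bags → Thin ρ b X N →
                Enclosure ρ b X bags → Enclosure ρ b (X ─ N) (N ∷ bags)
  Enclosure-─ {ρ} {b} {X} {N} {bags} N⊆X connN touchN thinN enclosure = record
    { connected = connN ∷ connected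
    ; joined    = All.zipWith (Product.map₁ (Disjoint-⊆ N⊆X)) (disjoint , touchN) ∷ joined
    ; disjoint  = (λ _ → x∈p─q⇒x∉q X N) ∷ All.map (Disjoint-⊆ (p─q⊆p X N)) disjoint
    ; thin-in-X = All.map (Thin-⊆ (p─q⊆p X N)) (thinN ∷ thin-in-X)
    ; boundary  = boundary′
    }
    where
    open Enclosure enclosure

    boundary′ : ∀ {p} → Boundary (X ─ N) p → p ∈ ⋃ (N ∷ bags)
    boundary′ {p} (p∉X─N , z , z∈X─N , zp) with p ∈? N | p ∈? X
    ... | yes p∈N | _ = p⊆p∪q (⋃ bags) p∈N
    ... | no p∉N | yes p∈X = contradiction (x∈p∧x∉q⇒x∈p─q p∈X p∉N) p∉X─N
    ... | no _ | no p∉X = q⊆p∪q N (⋃ bags) (boundary (p∉X , z , p─q⊆p X N z∈X─N , zp))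

  Enclosure-Closed : ∀ {ρ b X Y bags} → Y ⊆ X → Closed X Y →
                     Enclosure ρ b X bags → Enclosure ρ b Y bags
  Enclosure-Closed Y⊆X closed enclosure = record
    { connected = connected
    ; joined    = joined
    ; disjoint  = All.map (Disjoint-⊆ Y⊆X) disjoint
    ; thin-in-X = All.map (Thin-⊆ Y⊆X) thin-in-X
    ; boundary  = λ ∂p@(_ , z , z∈Y , zp) → boundary (closed ∂p , z , Y⊆X z∈Y , zp)
    }
    where open Enclosure enclosure

  Enclosure-filter : ∀ {ρ b X bags} → Enclosure ρ b X bags →
                     Enclosure ρ b X (filter (touch? X) bags)
  Enclosure-filter {X = X} {bags} enclosure = record
    { connected = All-filter⁺ (touch? X) connected
    ; joined    = AllPairs-filter⁺ (touch? X) joined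
    ; disjoint  = All-filter⁺ (touch? X) disjoint
    ; thin-in-X = All-filter⁺ (touch? X) thin-in-X
    ; boundary  = λ ∂p@(_ , z , z∈X , zp) →
        let _ , B∈bags , p∈B = find (∈-⋃⁻ bags (boundary ∂p))
        in ∈-⋃⁺ (lose (∈-filter⁺ (touch? X) B∈bags (z , z∈X , _ , p∈B , zp)) p∈B)
    }
    where open Enclosure enclosure

  record Territory (ρ b : ℕ) (X : Subset n) : Set where
    field
      bags        : List (Subset n)
      enclosure   : Enclosure ρ b X bags
      X-connected : Connected X
      touching    : All (Touch X) bags

  Component⇒Territory : ∀ {ρ b X x bags} → Enclosure ρ b X bags → (C : Component X x) →
                        Territory ρ b (Component.carrier C)
  Component⇒Territory {bags = bags} enclosure C = record
    { bags        = filter (touch? carrier) bags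
    ; enclosure   = Enclosure-filter (Enclosure-Closed carrier⊆X closed enclosure)
    ; X-connected = _ , rooted
    ; touching    = all-filter (touch? carrier) bags
    }
    where open Component C

  ¬CliqueMinor⇒length-bags≤ : ∀ {ρ b X s} → ¬ CliqueMinor G (suc (suc s)) →
                              (T : Territory ρ b X) → length (Territory.bags T) ≤ s
  ¬CliqueMinor⇒length-bags≤ noMinor T = ≤-pred (¬CliqueMinor⇒length≤ noMinor
    (X-connected ∷ connected)
    (All.zip (disjoint , touching) ∷ joined))
    where
    open Territory T
    open Enclosure enclosure

-- The robber has speed r + 1 and K_(s+2) is the excluded minor. The cops watch
-- what the robber can reach in one move followed by r steps of the next.
watchRadius : ℕ → ℕ
watchRadius r = suc r + r

bagWidth : ℕ → ℕ → ℕ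
bagWidth r s = suc (s * window (watchRadius r))

copNumber : ℕ → ℕ → ℕ
copNumber r s = suc s * bagWidth r s

module Game (G : Graph) where
  open Graph G hiding (sym)
  open Walks G

  Guards : Subset n → ℕ → Subset n → Fin n → Set
  Guards S m X x = ∀ {p} → p ∉ X → Within X m x p → p ∈ S

  Guards-step : ∀ {S m X x y} → x ∈ X → Adj x y → Guards S (suc m) X x → Guards S m X y
  Guards-step x∈X xy guards p∉X = guards p∉X ∘ step x∈X xy

  -- A boundary vertex first met at the very last step of the robber's move need
  -- not be occupied before the move: the robber then stops on a vertex of S′.
  Guards-confine : ∀ {S S′ m X x x′} → Guards S m X x → Guards S′ (suc m) X x → x ∈ X →
                   Reach G (S ∩ S′) (suc m) x x′ → x′ ∈ S′ ⊎ x′ ∈ X × Within X (suc m) x x′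
  Guards-confine _ _ x∈X (here _) = inj₂ (x∈X , here)
  Guards-confine {X = X} guards guards′ x∈X (step {y = y} _ xy rest) with y ∈? X | rest
  ... | yes y∈X | here _ = inj₂ (y∈X , step x∈X xy here)
  ... | no y∉X | here _ = inj₁ (guards′ y∉X (step x∈X xy here))
  ... | yes y∈X | step _ _ _ =
    Sum.map₂ (Product.map₂ (step x∈X xy))
             (Guards-confine (Guards-step x∈X xy guards) (Guards-step x∈X xy guards′) y∈X rest)
  ... | no y∉X | step y∉S∩S′ _ _ =
    contradiction (x∈p∩q⁺ (guards y∉X (step x∈X xy here) , guards′ y∉X (step x∈X xy here))) y∉S∩S′

  CopsWinFrom-∅⇒CopsWin : ∀ {r k} → (∀ x → CopsWinFrom G r k ∅ x) → CopsWin G r k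
  CopsWinFrom-∅⇒CopsWin wins = ∅ , ≤-trans (≤-reflexive (∣⊥∣≡0 n)) z≤n , inj₂ ∘ wins

module Strategy (G : Graph) (adj? : Decidable (Graph.Adj G)) where
  open Graph G hiding (sym)
  open Walks G
  open Geodesics G adj?
  open Territories G adj?
  open Game G

  boundary⇒Guards : ∀ {ρ N X Y x y k m} → (∀ {p} → Boundary Y p → p ∈ N) → Y ⊆ X → y ∈ Y →
                    Within X k x y → k + m ≤ ρ → Guards (N ∩ ball X ρ x) m Y y
  boundary⇒Guards boundary Y⊆X y∈Y xy k+m≤ρ p∉Y yp = x∈p∩q⁺
    ( boundary (Within-exit y∈Y p∉Y yp)
    , ∈-ball⁺ (Within-≤ k+m≤ρ (Within-trans xy (Within-⊆ Y⊆X yp))) )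

  module _ (r s : ℕ) (noMinor : ¬ CliqueMinor G (suc (suc s))) where

    ρ : ℕ
    ρ = watchRadius r

    record Position (S : Subset n) (x : Fin n) (X : Subset n) : Set where
      field
        x∈X       : x ∈ X
        territory : Territory ρ (bagWidth r s) X
        guards    : Guards S r X x

    opening : ∀ x → ∃ (Position ∅ x)
    opening x = carrier , record
      { x∈X       = proj₁ rooted
      ; territory = Component⇒Territory Enclosure-⊤ C
      ; guards    = λ p∉C xp →
          contradiction ∈⊤ (closed (Within-exit (proj₁ rooted) p∉C xp))
      }
      where
      C : Component ⊤ x
      C = component ∈⊤
      open Component C

    module Reply {S x X} (position : Position S x X) where
      open Position position
      open Territory territory
      open Enclosure enclosure

      length-bags≤s : length bags ≤ s
      length-bags≤s = ¬CliqueMinor⇒length-bags≤ noMinor territory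

      newBag : Fan ρ X x bags
      newBag = fan X-connected x∈X touching

      open Fan newBag using () renaming
        (carrier to N; rooted to N-rooted; carrier⊆X to N⊆X; touching to N-touching; thin-in-X to N-thin)

      N-bagWidth-thin : Thin ρ (bagWidth r s) X N
      N-bagWidth-thin = Thin-≤ (s≤s (*-monoˡ-≤ (window ρ) length-bags≤s)) N-thin

      X─N-enclosure : Enclosure ρ (bagWidth r s) (X ─ N) (N ∷ bags)
      X─N-enclosure = Enclosure-─ N⊆X (x , N-rooted) N-touching N-bagWidth-thin enclosure

      S′ : Subset n
      S′ = ⋃ (N ∷ bags) ∩ ball X ρ x

      ∣S′∣≤copNumber : ∣ S′ ∣ ≤ copNumber r s
      ∣S′∣≤copNumber = ≤-trans (∣∩ball∣≤ (Thin-⋃ (N-bagWidth-thin ∷ thin-in-X)) x∈X)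
                               (*-monoˡ-≤ (bagWidth r s) (s≤s length-bags≤s))

      guards′ : Guards S′ (suc r) X x
      guards′ = boundary⇒Guards
        (q⊆p∪q N (⋃ bags) ∘ boundary) ⊆-refl x∈X (here {m = 0}) (m≤m+n (suc r) r)

      N-occupied : ∀ {x′} → x′ ∈ N → Within X (suc r) x x′ → x′ ∈ S′
      N-occupied x′∈N xx′ = x∈p∩q⁺
        ( p⊆p∪q (⋃ bags) x′∈N
        , ∈-ball⁺ (Within-≤ (m≤m+n (suc r) r) xx′) )

      advance : ∀ {x′} → x′ ∈ X ─ N → Within X (suc r) x x′ → ∃ λ X′ → X′ ⊂ X × Position S′ x′ X′
      advance {x′} x′∈X─N xx′ = carrier , carrier⊂X , record
        { x∈X       = proj₁ rooted
        ; territory = Component⇒Territory X─N-enclosure C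
        ; guards    = boundary⇒Guards
            (Enclosure.boundary (Enclosure-Closed carrier⊆X closed X─N-enclosure))
            (proj₁ carrier⊂X) (proj₁ rooted) xx′ ≤-refl
        }
        where
        C : Component (X ─ N) x′
        C = component x′∈X─N
        open Component C

        carrier⊂X : carrier ⊂ X
        carrier⊂X = ⊆-⊂-trans carrier⊆X
          (p∩q≢∅⇒p─q⊂p X N (x , x∈p∩q⁺ (x∈X , proj₁ N-rooted)))

      respond : ∀ {x′} → Reach G (S ∩ S′) (suc r) x x′ →
                x′ ∈ S′ ⊎ ∃ λ X′ → X′ ⊂ X × Position S′ x′ X′
      respond {x′} move with Guards-confine guards guards′ x∈X move
      ... | inj₁ x′∈S′ = inj₁ x′∈S′
      ... | inj₂ (x′∈X , xx′) with x′ ∈? N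
      ... | yes x′∈N = inj₁ (N-occupied x′∈N xx′)
      ... | no x′∉N = inj₂ (advance (x∈p∧x∉q⇒x∈p─q x′∈X x′∉N) xx′)

    Position⇒CopsWinFrom : ∀ {S x X} → Acc _⊂_ X → Position S x X →
                           CopsWinFrom G (suc r) (copNumber r s) S x
    Position⇒CopsWinFrom (acc rec) position = win S′ ∣S′∣≤copNumber λ _ →
      Sum.map₂ (λ (_ , X′⊂X , position′) → Position⇒CopsWinFrom (rec X′⊂X) position′) ∘ respond
      where open Reply position

    CliqueMinor-free⇒CopsWin : CopsWin G (suc r) (copNumber r s)
    CliqueMinor-free⇒CopsWin = CopsWinFrom-∅⇒CopsWin λ x →
      Position⇒CopsWinFrom (⊂-wellFounded _) (proj₂ (opening x))

module SpanningSubgraphs (G : Graph) where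
  open Graph G renaming (sym to Adj-sym)
  open Game G

  record SpanningSubgraph : Set₁ where
    field
      Edge     : Fin n → Fin n → Set
      Edge-sym : ∀ {u v} → Edge u v → Edge v u
      Edge⇒Adj : ∀ {u v} → Edge u v → Adj u v

    graph : Graph
    graph = record { n = n ; Adj = Edge ; sym = Edge-sym ; irref = irref ∘ Edge⇒Adj }

  module _ (H : SpanningSubgraph) where
    open SpanningSubgraph H

    WalkIn-supergraph : ∀ {P u v} → WalkIn graph P u v → WalkIn G P u v
    WalkIn-supergraph (here pu) = here pu
    WalkIn-supergraph (step pu uv w) = step pu (Edge⇒Adj uv) (WalkIn-supergraph w)

    CliqueMinor-supergraph : ∀ {t} → CliqueMinor graph t → CliqueMinor G t
    CliqueMinor-supergraph minor = record
      { branch    = branch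
      ; nonempty  = nonempty
      ; connected = λ i u v u∈ v∈ → WalkIn-supergraph (connected i u v u∈ v∈)
      ; adjacent  = λ i j i≢j →
          let u , v , u∈ , v∈ , uv = adjacent i j i≢j in u , v , u∈ , v∈ , Edge⇒Adj uv
      }
      where open CliqueMinor minor

    UnseenEdge : Set
    UnseenEdge = ∃₂ λ u v → Adj u v × ¬ Edge u v

    module _ (edge? : Decidable Edge) where

      Reach-subgraph : ∀ {S m x y} → Reach G S m x y → Reach graph S m x y ⊎ UnseenEdge
      Reach-subgraph (here x∉S) = inj₁ (here x∉S)
      Reach-subgraph (step {x = x} {y = y} x∉S xy w) with edge? x y
      ... | yes xy∈H = Sum.map₁ (step x∉S xy∈H) (Reach-subgraph w)
      ... | no xy∉H = inj₂ (x , y , xy , xy∉H)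

      CopsWinFrom-supergraph : ∀ {r k} → (UnseenEdge → ∀ S x → CopsWinFrom G r k S x) →
                               ∀ {S x} → CopsWinFrom graph r k S x → CopsWinFrom G r k S x
      CopsWinFrom-supergraph {r} {k} restart (win S′ ∣S′∣≤k respond) =
        win S′ ∣S′∣≤k λ x′ move → continue (Reach-subgraph move)
        where
        continue : ∀ {x′} → Reach graph _ r _ x′ ⊎ UnseenEdge → x′ ∈ S′ ⊎ CopsWinFrom G r k S′ x′
        continue (inj₂ unseen) = inj₂ (restart unseen S′ _)
        continue (inj₁ move) with respond _ move
        ... | inj₁ caught = inj₁ caught
        ... | inj₂ wins = inj₂ (CopsWinFrom-supergraph restart wins)

  Sound : Subset (n * n) → Set
  Sound E = ∀ u v → combine u v ∈ E → Adj u v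

  edgeSubgraph : ∀ {E} → Sound E → SpanningSubgraph
  edgeSubgraph {E} sound = record
    { Edge     = λ u v → combine u v ∈ E ⊎ combine v u ∈ E
    ; Edge-sym = Sum.swap
    ; Edge⇒Adj = [ sound _ _ , Adj-sym ∘ sound _ _ ]′
    }

  edgeSubgraph? : ∀ {E} (sound : Sound E) → Decidable (SpanningSubgraph.Edge (edgeSubgraph sound))
  edgeSubgraph? {E} _ u v = combine u v ∈? E ⊎-dec combine v u ∈? E

  Sound-∪⁅⁆ : ∀ {E u v} → Sound E → Adj u v → Sound (E ∪ ⁅ combine u v ⁆)
  Sound-∪⁅⁆ {E} {u} {v} sound uv u′ v′ e∈ with x∈p∪q⁻ E ⁅ combine u v ⁆ e∈
  ... | inj₁ e∈E = sound u′ v′ e∈E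
  ... | inj₂ e∈⁅uv⁆ with refl , refl ← combine-injective u′ v′ u v (x∈⁅y⁆⇒x≡y _ e∈⁅uv⁆) = uv

  module _ {r k} (wins : ∀ H → Decidable (SpanningSubgraph.Edge H) →
                         CopsWin (SpanningSubgraph.graph H) r k) where

    Sound⇒CopsWinFrom : ∀ {E} → Acc _⊃_ E → Sound E → ∀ S x → CopsWinFrom G r k S x
    Sound⇒CopsWinFrom (acc rec) sound S x =
      let S₀ , ∣S₀∣≤k , wins₀ = wins H (edgeSubgraph? sound)
      in win S₀ ∣S₀∣≤k λ x₀ _ →
           Sum.map₂ (CopsWinFrom-supergraph H (edgeSubgraph? sound) restart) (wins₀ x₀)
      where
      H : SpanningSubgraph
      H = edgeSubgraph sound

      restart : UnseenEdge H → ∀ S x → CopsWinFrom G r k S x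
      restart (u , v , uv , uv∉H) =
        Sound⇒CopsWinFrom (rec (x∉p⇒p⊂p∪⁅x⁆ (uv∉H ∘ inj₁))) (Sound-∪⁅⁆ sound uv)

    decidableSubgraphs⇒CopsWin : CopsWin G r k
    decidableSubgraphs⇒CopsWin = CopsWinFrom-∅⇒CopsWin
      (Sound⇒CopsWinFrom (⊃-wellFounded ∅) (λ _ _ e∈∅ → contradiction e∈∅ ∉⊥) ∅)

2*[1+n]C2≡[1+n]*n : ∀ n → 2 * (suc n C 2) ≡ suc n * n
2*[1+n]C2≡[1+n]*n zero = refl
2*[1+n]C2≡[1+n]*n (suc n) = begin
  2 * (suc (suc n) C 2)              ≡⟨ cong (2 *_) (nCk+nC[k+1]≡[n+1]C[k+1] (suc n) 1) ⟨
  2 * (suc n C 1 + suc n C 2)        ≡⟨ *-distribˡ-+ 2 (suc n C 1) (suc n C 2) ⟩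
  2 * (suc n C 1) + 2 * (suc n C 2)  ≡⟨ cong₂ (λ a b → 2 * a + b) (nC1≡n (suc n)) (2*[1+n]C2≡[1+n]*n n) ⟩
  2 * suc n + suc n * n              ≡⟨ factor n ⟩
  suc (suc n) * suc n                ∎
  where
  open ≡-Reasoning
  factor : ∀ n → 2 * suc n + suc n * n ≡ suc (suc n) * suc n
  factor = solve-∀

copNumber≤ : ∀ r s → copNumber r (suc s) ≤ (suc (suc s) C 2) * (8 * suc r + 1)
copNumber≤ r s = *-cancelˡ-≤ 2 (begin
  2 * copNumber r (suc s)                              ≤⟨ m≤m+n _ (suc (suc s) * (3 * s + 1)) ⟩
  2 * copNumber r (suc s) + suc (suc s) * (3 * s + 1)  ≡⟨ expand s r ⟩
  suc (suc s) * suc s * (8 * suc r + 1)                ≡⟨ cong (_* (8 * suc r + 1)) (2*[1+n]C2≡[1+n]*n (suc s)) ⟨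
  2 * (suc (suc s) C 2) * (8 * suc r + 1)              ≡⟨ *-assoc 2 (suc (suc s) C 2) (8 * suc r + 1) ⟩
  2 * ((suc (suc s) C 2) * (8 * suc r + 1))            ∎)
  where
  open ≤-Reasoning
  expand : ∀ s r → 2 * (suc (suc s) * suc (suc s * suc (suc r + r + (suc r + r)))) +
                   suc (suc s) * (3 * s + 1) ≡ suc (suc s) * suc s * (8 * suc r + 1)
  expand = solve-∀

theorem5 : (r t : ℕ) → 1 ≤ r → 3 ≤ t → (G : Graph) → ¬ HasCliqueMinor G t →
    CopWidthAtMost G r (((t ∸ 1) C 2) * (8 * r + 1))
theorem5 (suc r) (suc (suc (suc s))) _ (s≤s (s≤s (s≤s _))) G noMinor =
  copNumber r (suc s) , s≤s z≤n , copNumber≤ r s ,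
  decidableSubgraphs⇒CopsWin λ H edge? →
    Strategy.CliqueMinor-free⇒CopsWin (SpanningSubgraph.graph H) edge? r (suc s)
      (noMinor ∘ CliqueMinor-supergraph H)
  where open SpanningSubgraphs G
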